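{- Let $G$ be a finite simple connected undirected interval graph with at least two edges. Then $2\le \chi_{cf}(G)\le 4$.
   Context: A graph $G$ is an interval graph if there is a family $\{I_v : v\in V(G)\}$ of real intervals such that, for distinct $u,v$, $I_u\cap I_v\neq\emptyset$ if and only if $uv\in E(G)$. Let $N(v)$ be the set of vertices adjacent to $v$. For a coloring $C_G$ of $V(G)$ (not necessarily proper), a set $U\subseteq V(G)$ has a unique color if there is a color $c$ with $|\{u\in U: C_G(u)=c\}|=1$. The coloring is a conflict-free open neighborhood (CF-ON) coloring if $N(v)$ has a unique color for every $v\in V(G)$. $\chi_{cf}(G)$ denotes the minimum number of colors in a CF-ON coloring of $G$. -}

module Defs where

open import Data.Fin.Base using (Fin)
import Data.Fin.Properties as Fin
open import Data.Fin.Subset using (Subset; _∩_; ∣_∣)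
open import Data.List.Base using (List; allFin; cartesianProduct; filter)
open import Data.Nat.Base using (ℕ; _≤_)
open import Data.Product.Base using (Σ-syntax; ∃-syntax; _×_; _,_)
open import Data.Rational.Base using (ℚ) renaming (_<_ to _<ℚ_)
open import Data.Sum.Base using (_⊎_)
open import Data.Vec.Base using (tabulate)
open import Function.Bundles using (_⇔_)
open import Level using (0ℓ)
open import Relation.Binary.Construct.Closure.ReflexiveTransitive using (Star)
open import Relation.Binary.Core using (Rel)
open import Relation.Binary.Definitions using (Decidable; Irreflexive; Symmetric)
open import Relation.Binary.PropositionalEquality.Core using (_≡_; _≢_)
open import Relation.Nullary using (¬_)
open import Relation.Nullary.Decidable.Core using (does; _×-dec_)
open import Relation.Unary using (Pred; _∈_; _⊆_; _≬_; Satisfiable)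

-- Real numbers as two-sided Dedekind cuts of the rationals: q ∈ lower
-- means q < x, and q ∈ upper means x < q.
record ℝ : Set₁ where
  field
    lower           : Pred ℚ 0ℓ
    upper           : Pred ℚ 0ℓ
    lower-inhabited : Satisfiable lower
    upper-inhabited : Satisfiable upper
    lower-rounded   : ∀ q → q ∈ lower ⇔ (∃[ r ] (q <ℚ r × r ∈ lower))
    upper-rounded   : ∀ r → r ∈ upper ⇔ (∃[ q ] (q <ℚ r × q ∈ upper))
    disjoint        : ∀ q → ¬ (q ∈ lower × q ∈ upper)
    located         : ∀ {q r} → q <ℚ r → q ∈ lower ⊎ r ∈ upper

infix 4 _≤ℝ_

_≤ℝ_ : Rel ℝ 0ℓ
x ≤ℝ y = ℝ.lower x ⊆ ℝ.lower y

-- Intervals of any kind (open, closed, half-open, bounded or not) are the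
-- order-convex sets of reals.  Convexity also makes membership respect
-- equality of reals, i.e. ≤ℝ in both directions.
record Interval : Set₁ where
  field
    points : Pred ℝ 0ℓ
    convex : ∀ {x y z} → x ∈ points → z ∈ points →
             x ≤ℝ y → y ≤ℝ z → y ∈ points

open Interval public using (points)

-- Adjacency in a finite graph is classically always decidable; here the
-- decision procedure is part of the data.
record Graph : Set₁ where
  field
    order  : ℕ
    Adj    : Rel (Fin order) 0ℓ
    sym    : Symmetric Adj
    irrefl : Irreflexive _≡_ Adj
    adj?   : Decidable Adj

  V : Set
  V = Fin order

open Graph public using (V; Adj)

IsIntervalGraph : Graph → Set₁
IsIntervalGraph G =
  Σ[ I ∈ (V G → Interval) ]
    (∀ u v → u ≢ v → (points (I u) ≬ points (I v)) ⇔ Adj G u v)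

Connected : Graph → Set
Connected G = ∀ u v → Star (Adj G) u v

-- Each undirected edge is listed once, smaller endpoint first.
edges : (G : Graph) → List (V G × V G)
edges G = filter (λ (u , v) → (u Fin.<? v) ×-dec Graph.adj? G u v)
                 (cartesianProduct (allFin (Graph.order G)) (allFin (Graph.order G)))

N : (G : Graph) → V G → Subset (Graph.order G)
N G v = tabulate (λ u → does (Graph.adj? G v u))

Coloring : Graph → ℕ → Set
Coloring G k = V G → Fin k

colorClass : (G : Graph) {k : ℕ} → Coloring G k → Fin k → Subset (Graph.order G)
colorClass G C c = tabulate (λ u → does (C u Fin.≟ c))

HasUniqueColor : (G : Graph) {k : ℕ} → Coloring G k → Subset (Graph.order G) → Set
HasUniqueColor G C U = ∃[ c ] ∣ U ∩ colorClass G C c ∣ ≡ 1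

IsCFON : (G : Graph) {k : ℕ} → Coloring G k → Set
IsCFON G C = ∀ v → HasUniqueColor G C (N G v)

-- Colorings need not use all k colors; this does not affect the minimum.
CFONColorable : Graph → ℕ → Set
CFONColorable G k = Σ[ C ∈ Coloring G k ] IsCFON G C

-- χ_cf as a relation, since a graph with an isolated vertex has no
-- CF-ON coloring at all.
χcf_≔_ : Graph → ℕ → Set
χcf G ≔ k = CFONColorable G k × (∀ m → CFONColorable G m → k ≤ m)

{-# OPTIONS --safe #-}
-- Order the vertices by the right ends of their intervals: if u ≤ v ≤ w and
-- u ~ w, then v ~ w.  Starting from the first vertex, walk repeatedly to the
-- last neighbour until the last vertex is reached.  Colour the walk cyclically
-- with three colours and every other vertex with a fourth.  A vertex u between
-- walk i and walk (i + 1) sees walk (i + 1), and no other vertex of that colour: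
-- an earlier one has all its neighbours before u, and a later one would be
-- adjacent to walk (i + 2) as well.  The last vertex sees only its predecessor
-- on the walk.  With a single colour all degrees would be 1, so a connected
-- graph would have only one edge.
--
-- The order of the reals is not decidable, but 4-colourability is, so the order
-- of the vertices is only needed up to double negation.
module Submission where

open import Defs
open import Data.Empty using (⊥-elim)
open import Data.Fin.Base
  using (Fin; zero; suc; toℕ; fromℕ<; combine; finToFun; funToFin)
open import Data.Fin.Properties
  using (_≟_; any?; all?; sequence; toℕ<n; toℕ-fromℕ<; toℕ-injective
        ; combine-injectiveʳ; combine-monoˡ-<; finToFun-funToFin)
open import Data.Fin.Subset using (Subset; ⁅_⁆; ∣_∣; _∩_; _⊂_) renaming (_∈_ to _∈ˢ_)
open import Data.Fin.Subset.Properties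
  using (x∈⁅x⁆; x∈⁅y⁆⇒x≡y; ∣⁅x⁆∣≡1; ⊆-antisym; p⊂q⇒∣p∣<∣q∣; ∣p∣≤n; x∈p∩q⁺; x∈p∩q⁻)
open import Data.List.Base using (_∷_; length; filter; allFin; cartesianProduct)
open import Data.List.Extrema.Nat
  using (argmax; argmin; argmax-sel; f[xs]≤f[argmax]; f[argmin]≤f[xs])
open import Data.List.Membership.Propositional using () renaming (_∈_ to _∈ˡ_)
open import Data.List.Membership.Propositional.Properties
  using (∈-filter⁺; ∈-filter⁻; ∈-allFin)
import Data.List.Relation.Unary.All as All
open import Data.List.Relation.Unary.AllPairs using (_∷_)
open import Data.List.Relation.Unary.Any using (here; there)
open import Data.List.Relation.Unary.Unique.Propositional using (Unique)
import Data.List.Relation.Unary.Unique.Propositional.Properties as Unique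
open import Data.Nat.Base using (ℕ; zero; suc; _+_; _≤_; _<_; z≤n; s≤s)
open import Data.Nat.Properties as ℕ
  using (≤-refl; ≤-reflexive; ≤-trans; ≤-antisym; <⇒≤; <⇒≱; <⇒≢; ≰⇒>; ≤∧≢⇒<; _≤?_
        ; <-≤-trans; <-irrefl; <-cmp; n≤1+n; +-suc; +-monoʳ-≤
        ; m<1+n⇒m<n∨m≡n)
open import Data.Product.Base using (∃-syntax; _×_; _,_; proj₁; proj₂)
import Data.Rational.Properties as ℚ
open import Data.Sum.Base using (_⊎_; inj₁; inj₂; [_,_]′)
open import Data.Vec.Base using (tabulate)
open import Data.Vec.Properties using (lookup∘tabulate; tabulate-cong; lookup⇒[]=; []=⇒lookup)
open import Effect.Monad using (RawMonad)
open import Function.Base using (_∘_; id)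
open import Function.Bundles using (_⇔_; module Equivalence)
open import Function.Definitions using (Injective)
open import Level using (Level; 0ℓ) renaming (suc to lsuc)
open import Relation.Binary.Construct.Closure.ReflexiveTransitive using (Star; ε; _◅_)
open import Relation.Binary.Core using (Rel)
import Relation.Binary.Definitions as Binary
open import Relation.Binary.Definitions using (tri<; tri≈; tri>)
open import Relation.Binary.PropositionalEquality
open import Relation.Nullary using (¬_; Dec; yes; no; contradiction)
open import Relation.Nullary.Decidable
  using (does; map′; dec-true; dec-false; decidable-stable; ¬¬-excluded-middle; _×-dec_)
open import Relation.Nullary.Negation using (¬¬-Monad; ¬¬-map)
open import Relation.Unary using (Pred; Decidable; _≬_)

-- Subsets of size one and decidability of CF-ON colorability

private
  variable
    ℓ : Level
    n : ℕ

module _ {P : Pred (Fin n) ℓ} (P? : Decidable P) where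

  ∈-comprehension⁺ : ∀ {x} → P x → x ∈ˢ tabulate (λ y → does (P? y))
  ∈-comprehension⁺ {x} px =
    lookup⇒[]= x _ (trans (lookup∘tabulate _ x) (dec-true (P? x) px))

  ∈-comprehension⁻ : ∀ {x} → x ∈ˢ tabulate (λ y → does (P? y)) → P x
  ∈-comprehension⁻ {x} x∈ = decidable-stable (P? x) λ ¬px →
    contradiction
      (trans (sym (dec-false (P? x) ¬px)) (trans (sym (lookup∘tabulate _ x)) ([]=⇒lookup x∈)))
      λ ()

∣p∣≡1⁺ : ∀ {p : Subset n} {x} → x ∈ˢ p → (∀ {y} → y ∈ˢ p → y ≡ x) → ∣ p ∣ ≡ 1
∣p∣≡1⁺ {p = p} {x} x∈p only = trans (cong ∣_∣ p≡⁅x⁆) (∣⁅x⁆∣≡1 x)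
  where
  p≡⁅x⁆ : p ≡ ⁅ x ⁆
  p≡⁅x⁆ = ⊆-antisym
    (λ y∈p → subst (_∈ˢ ⁅ x ⁆) (sym (only y∈p)) (x∈⁅x⁆ x))
    (λ y∈⁅x⁆ → subst (_∈ˢ p) (sym (x∈⁅y⁆⇒x≡y x y∈⁅x⁆)) x∈p)

-- If `x` and `y` differed, `⁅ x ⁆` would be a proper subset of `p`, forcing `∣ p ∣` above 1.
∣p∣≡1⁻ : ∀ {p : Subset n} {x y} → ∣ p ∣ ≡ 1 → x ∈ˢ p → y ∈ˢ p → x ≡ y
∣p∣≡1⁻ {p = p} {x} {y} ∣p∣≡1 x∈p y∈p = decidable-stable (x ≟ y) λ x≢y →
  <⇒≢ (p⊂q⇒∣p∣<∣q∣ {p = ⁅ x ⁆} {q = p}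
        ( (λ z∈⁅x⁆ → subst (_∈ˢ p) (sym (x∈⁅y⁆⇒x≡y x z∈⁅x⁆)) x∈p)
        , y , y∈p , x≢y ∘ sym ∘ x∈⁅y⁆⇒x≡y x))
      (trans (∣⁅x⁆∣≡1 x) (sym ∣p∣≡1))

module _ (G : Graph) where
  open Graph G using (order; adj?)

  ∈-N∩class⁺ : ∀ {k} (C : Coloring G k) {c v x} → Adj G v x → C x ≡ c →
               x ∈ˢ N G v ∩ colorClass G C c
  ∈-N∩class⁺ C {c} {v} vx Cx =
    x∈p∩q⁺ (∈-comprehension⁺ (adj? v) vx , ∈-comprehension⁺ (λ u → C u ≟ c) Cx)

  ∈-N∩class⁻ : ∀ {k} (C : Coloring G k) {c v x} → x ∈ˢ N G v ∩ colorClass G C c →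
               Adj G v x × C x ≡ c
  ∈-N∩class⁻ C {c} {v} x∈ =
    let x∈N , x∈C = x∈p∩q⁻ _ _ x∈ in
    ∈-comprehension⁻ (adj? v) x∈N , ∈-comprehension⁻ (λ u → C u ≟ c) x∈C

  IsCFON? : ∀ {k} (C : Coloring G k) → Dec (IsCFON G C)
  IsCFON? C = all? λ v → any? λ c → ∣ N G v ∩ colorClass G C c ∣ ℕ.≟ 1

  -- Lets a coloring be replaced by its decoded code, which agrees with it only pointwise.
  IsCFON-resp-≗ : ∀ {k} {C D : Coloring G k} → C ≗ D → IsCFON G C → IsCFON G D
  IsCFON-resp-≗ C≗D cf v =
    let c , ∣c∣≡1 = cf v in
    c , trans (cong (λ p → ∣ N G v ∩ p ∣)
                    (tabulate-cong λ u → cong (λ d → does (d ≟ c)) (sym (C≗D u))))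
              ∣c∣≡1

  -- Colorings are coded by the elements of a finite set, so all of them can be tested. This serves
  -- both to find the minimum and to discharge a double negation.
  CFONColorable? : ∀ k → Dec (CFONColorable G k)
  CFONColorable? k = map′
    (λ (i , cf) → finToFun i , cf)
    (λ (C , cf) → funToFin C , IsCFON-resp-≗ (sym ∘ finToFun-funToFin C) cf)
    (any? λ i → IsCFON? (finToFun {k} {order} i))

-- The lower bound

module _ (G : Graph) where
  open Graph G using (order; adj?)

  private
    Edge? : Decidable (λ ((u , v) : V G × V G) → toℕ u < toℕ v × Adj G u v)
    Edge? (u , v) = (toℕ u ℕ.<? toℕ v) ×-dec adj? u v

  ∈-edges⁻ : ∀ {u v} → (u , v) ∈ˡ edges G → toℕ u < toℕ v × Adj G u v
  ∈-edges⁻ uv∈ = proj₂ (∈-filter⁻ Edge? {xs = cartesianProduct (allFin order) (allFin order)} uv∈)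

  edges-unique : Unique (edges G)
  edges-unique = Unique.filter⁺ Edge?
    (Unique.cartesianProduct⁺ (Unique.allFin⁺ order) (Unique.allFin⁺ order))

  two-edges : 2 ≤ length (edges G) →
              ∃[ e ] ∃[ f ] (e ≢ f × e ∈ˡ edges G × f ∈ˡ edges G)
  two-edges 2≤ with edges G | edges-unique
  two-edges (s≤s (s≤s _)) | e ∷ f ∷ _ | (e≢f All.∷ _) ∷ _ =
    e , f , e≢f , here refl , there (here refl)

  module _ (connected : Connected G) (2≤∣E∣ : 2 ≤ length (edges G)) where

    -- A path starting at the end `a` of the edge `ab` can only alternate between `a` and `b`. So a
    -- second edge also has both ends in this pair, and as edges list the smaller end first it
    -- equals the first edge.
    ¬degrees≤1 : ¬ (∀ {v x y} → Adj G v x → Adj G v y → x ≡ y)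
    ¬degrees≤1 only with two-edges 2≤∣E∣
    ... | (a , b) , (c , d) , e≢f , e∈ , f∈ with ∈-edges⁻ e∈ | ∈-edges⁻ f∈
    ... | a<b , ab | c<d , cd with reach (inj₁ refl) (connected a c)
                                 | reach (inj₁ refl) (connected a d)
      where
      reach : ∀ {u w} → u ≡ a ⊎ u ≡ b → Star (Adj G) u w → w ≡ a ⊎ w ≡ b
      reach u≡          ε         = u≡
      reach (inj₁ refl) (ax ◅ xw) = reach (inj₂ (only ax ab)) xw
      reach (inj₂ refl) (bx ◅ xw) = reach (inj₁ (only bx (Graph.sym G ab))) xw
    ... | inj₁ refl | inj₁ refl = <-irrefl refl c<d
    ... | inj₁ refl | inj₂ refl = e≢f refl
    ... | inj₂ refl | inj₁ refl = ℕ.<-asym a<b c<d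
    ... | inj₂ refl | inj₂ refl = <-irrefl refl c<d

    2≤colors : ∀ {k} → CFONColorable G k → 2 ≤ k
    2≤colors {zero} (C , _) with () ← C (proj₁ (proj₁ (two-edges 2≤∣E∣)))
    2≤colors {suc zero} (C , cf) = ⊥-elim (¬degrees≤1 λ {v} vx vy →
      let c , ∣c∣≡1 = cf v in
      ∣p∣≡1⁻ ∣c∣≡1 (∈-N∩class⁺ G C vx (one-color _ c)) (∈-N∩class⁺ G C vy (one-color _ c)))
      where
      one-color : (c d : Fin 1) → c ≡ d
      one-color zero zero = refl
    2≤colors {suc (suc _)} _ = s≤s (s≤s z≤n)

-- Residues modulo three

residue : ℕ → Fin 3
residue 0 = zero
residue 1 = suc zero
residue 2 = suc (suc zero)
residue (suc (suc (suc i))) = residue i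

residue-≡ : ∀ i j → residue i ≡ residue j → i ≡ j ⊎ 3 + i ≤ j ⊎ 3 + j ≤ i
residue-≡ 0 0 _ = inj₁ refl
residue-≡ 1 1 _ = inj₁ refl
residue-≡ 2 2 _ = inj₁ refl
residue-≡ 0 (suc (suc (suc j))) _ = inj₂ (inj₁ (s≤s (s≤s (s≤s z≤n))))
residue-≡ 1 (suc (suc (suc zero))) ()
residue-≡ 1 (suc (suc (suc (suc j)))) _ = inj₂ (inj₁ (s≤s (s≤s (s≤s (s≤s z≤n)))))
residue-≡ 2 (suc (suc (suc zero))) ()
residue-≡ 2 (suc (suc (suc (suc zero)))) ()
residue-≡ 2 (suc (suc (suc (suc (suc j))))) _ = inj₂ (inj₁ (s≤s (s≤s (s≤s (s≤s (s≤s z≤n))))))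
residue-≡ (suc (suc (suc i))) 0 _ = inj₂ (inj₂ (s≤s (s≤s (s≤s z≤n))))
residue-≡ (suc (suc (suc zero))) 1 ()
residue-≡ (suc (suc (suc (suc i)))) 1 _ = inj₂ (inj₂ (s≤s (s≤s (s≤s (s≤s z≤n)))))
residue-≡ (suc (suc (suc zero))) 2 ()
residue-≡ (suc (suc (suc (suc zero)))) 2 ()
residue-≡ (suc (suc (suc (suc (suc i))))) 2 _ = inj₂ (inj₂ (s≤s (s≤s (s≤s (s≤s (s≤s z≤n))))))
residue-≡ (suc (suc (suc i))) (suc (suc (suc j))) eq with residue-≡ i j eq
... | inj₁ refl       = inj₁ refl
... | inj₂ (inj₁ i<j) = inj₂ (inj₁ (s≤s (s≤s (s≤s i<j))))
... | inj₂ (inj₂ j<i) = inj₂ (inj₂ (s≤s (s≤s (s≤s j<i))))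

-- The greedy walk

module Greedy
  (G : Graph) (connected : Connected G)
  (key : V G → ℕ) (key-injective : Injective _≡_ _≡_ key)
  (umbrella : ∀ {u v w} → key u ≤ key v → key v ≤ key w → v ≢ w → Adj G u w → Adj G v w)
  {a b : V G} (ab : Adj G a b)
  where

  open Graph G using (order; adj?; irrefl) renaming (sym to Adj-sym)

  first last : V G
  first = argmin key a (allFin order)
  last  = argmax key a (allFin order)

  first-least : ∀ v → key first ≤ key v
  first-least v = All.lookup (f[argmin]≤f[xs] a (allFin order)) (∈-allFin v)

  last-greatest : ∀ v → key v ≤ key last
  last-greatest v = All.lookup (f[xs]≤f[argmax] a (allFin order)) (∈-allFin v)

  -- Otherwise all keys coincide, hence all vertices do, and the edge `ab` is a loop.
  first≢last : first ≢ last
  first≢last eq = irrefl (trans (all-last a) (sym (all-last b))) ab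
    where
    all-last : ∀ v → v ≡ last
    all-last v = key-injective (≤-antisym (last-greatest v)
      (≤-trans (≤-reflexive (cong key (sym eq))) (first-least v)))

  -- v itself when no neighbour of v comes after v
  next : V G → V G
  next v = argmax key v (filter (adj? v) (allFin order))

  next-greatest : ∀ {v w} → Adj G v w → key w ≤ key (next v)
  next-greatest {v} {w} vw =
    All.lookup (f[xs]≤f[argmax] v _) (∈-filter⁺ (adj? v) (∈-allFin w) vw)

  next-adj : ∀ {v} → key v < key (next v) → Adj G v (next v)
  next-adj {v} v< with argmax-sel key v (filter (adj? v) (allFin order))
  ... | inj₁ eq = contradiction (cong key (sym eq)) (<⇒≢ v<)
  ... | inj₂ ∈N = proj₂ (∈-filter⁻ (adj? v) {xs = allFin order} ∈N)

  -- Some edge x y of a path from v to the last vertex has x ≤ v < y, and then v ~ y.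
  last-neighbor-after : ∀ {v} → v ≢ last → ∃[ w ] (Adj G v w × key v < key w)
  last-neighbor-after {v} v≢last = crossing ≤-refl (connected v last)
    where
    crossing : ∀ {x} → key x ≤ key v → Star (Adj G) x last → ∃[ w ] (Adj G v w × key v < key w)
    crossing last≤v ε =
      contradiction (key-injective (≤-antisym (last-greatest v) last≤v)) v≢last
    crossing {x} x≤v (_◅_ {j = y} xy yl) with key y ≤? key v
    ... | yes y≤v = crossing y≤v yl
    ... | no  y≰v = y , umbrella x≤v (<⇒≤ v<y) (λ { refl → <-irrefl refl v<y }) xy , v<y
      where
      v<y : key v < key y
      v<y = ≰⇒> y≰v

  next-after : ∀ {v} → v ≢ last → key v < key (next v)
  next-after v≢last =
    let w , vw , v<w = last-neighbor-after v≢last in <-≤-trans v<w (next-greatest vw)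

  walk : ℕ → V G
  walk zero    = first
  walk (suc i) = next (walk i)

  -- Before the last vertex every step raises the key by at least one, so `key last` units of fuel
  -- are enough.
  walk-terminates : ∃[ m ] (walk m ≡ last × (∀ {i} → i < m → walk i ≢ last))
  walk-terminates = search (key last) 0 (ℕ.m≤m+n _ _) λ ()
    where
    search : ∀ fuel i → key last ≤ fuel + key (walk i) → (∀ {j} → j < i → walk j ≢ last) →
             ∃[ m ] (walk m ≡ last × (∀ {j} → j < m → walk j ≢ last))
    search fuel i enough before with walk i ≟ last
    ... | yes eq = i , eq , before
    search zero i enough before | no ≢last =
      contradiction (key-injective (≤-antisym (last-greatest _) enough)) ≢last
    search (suc fuel) i enough before | no ≢last = search fuel (suc i)
      (≤-trans enough (≤-trans (≤-reflexive (sym (+-suc fuel _)))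
        (+-monoʳ-≤ fuel (next-after ≢last))))
      λ j<1+i → [ before , (λ { refl → ≢last }) ]′ (m<1+n⇒m<n∨m≡n j<1+i)

  m : ℕ
  m = proj₁ walk-terminates

  walk-m : walk m ≡ last
  walk-m = proj₁ (proj₂ walk-terminates)

  walk-suc-< : ∀ {i} → i < m → key (walk i) < key (walk (suc i))
  walk-suc-< i<m = next-after (proj₂ (proj₂ walk-terminates) i<m)

  walk-adj : ∀ {i} → i < m → Adj G (walk i) (walk (suc i))
  walk-adj i<m = next-adj (walk-suc-< i<m)

  walk-< : ∀ {i j} → i < j → j ≤ m → key (walk i) < key (walk j)
  walk-< {i} {suc j} i<1+j j<m with m<1+n⇒m<n∨m≡n i<1+j
  ... | inj₁ i<j  = ℕ.<-trans (walk-< i<j (<⇒≤ j<m)) (walk-suc-< j<m)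
  ... | inj₂ refl = walk-suc-< j<m

  walk-injective : ∀ {i j} → i ≤ m → j ≤ m → walk i ≡ walk j → i ≡ j
  walk-injective {i} {j} i≤m j≤m eq with <-cmp i j
  ... | tri< i<j _ _ = contradiction (cong key eq) (<⇒≢ (walk-< i<j j≤m))
  ... | tri≈ _ i≡j _ = i≡j
  ... | tri> _ _ j<i = contradiction (cong key (sym eq)) (<⇒≢ (walk-< j<i i≤m))

  -- Going down from `k`, `walk i` is the first walk vertex met that is not after `u`; at the latest
  -- this is `first`.
  bracket : ∀ k {u} → key u ≤ key (walk k) → u ≢ walk k →
            ∃[ i ] (i < k × key (walk i) ≤ key u × key u ≤ key (walk (suc i)) × u ≢ walk (suc i))
  bracket zero {u} u≤ u≢ = contradiction (key-injective (≤-antisym u≤ (first-least u))) u≢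
  bracket (suc k) {u} u≤ u≢ with key (walk k) ≤? key u
  ... | yes ≤u = k , ≤-refl , ≤u , u≤ , u≢
  ... | no  ≰u =
    let i , i<k , rest = bracket k (<⇒≤ (≰⇒> ≰u)) (λ { refl → ≰u ≤-refl }) in
    i , ℕ.<-trans i<k ≤-refl , rest

  -- Comparing walk vertices is enough, since the colors `suc r` never occur off the walk.
  UniquelySeen : V G → ℕ → Set
  UniquelySeen u i = i ≤ m × Adj G u (walk i) ×
    (∀ {j} → j ≤ m → Adj G u (walk j) → residue j ≡ residue i → j ≡ i)

  seen-by-last : ∃[ i ] UniquelySeen last i
  seen-by-last = before m refl
    where
    before : ∀ k → m ≡ k → ∃[ i ] UniquelySeen last i
    before zero    m≡0   = contradiction (trans (cong walk (sym m≡0)) walk-m) first≢last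
    before (suc i) m≡1+i =
      i , <⇒≤ i<m , subst (λ v → Adj G v (walk i)) walk-1+i (Adj-sym (walk-adj i<m)) , only
      where
      i<m : i < m
      i<m = ≤-reflexive (sym m≡1+i)

      walk-1+i : walk (suc i) ≡ last
      walk-1+i = trans (cong walk (sym m≡1+i)) walk-m

      only : ∀ {j} → j ≤ m → Adj G last (walk j) → residue j ≡ residue i → j ≡ i
      only {j} j≤m lj eq with residue-≡ j i eq
      ... | inj₁ j≡i = j≡i
      -- A neighbor of `walk j` is not after `walk (suc j)`, but here `suc j < m` and the neighbor
      -- is `last`.
      ... | inj₂ (inj₁ 3+j≤i) = contradiction
              (subst (λ v → key v ≤ key (walk (suc j))) (sym walk-m) (next-greatest (Adj-sym lj)))
              (<⇒≱ (walk-< (≤-trans (n≤1+n _) (≤-trans 3+j≤i (<⇒≤ i<m))) ≤-refl))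
      ... | inj₂ (inj₂ 3+i≤j) = contradiction
              (≤-trans 3+i≤j (≤-trans j≤m (≤-reflexive m≡1+i)))
              (<⇒≱ (n≤1+n _))

  seen-by-other : ∀ {u} → u ≢ last → ∃[ i ] UniquelySeen u i
  seen-by-other {u} u≢last
    with bracket m (≤-trans (last-greatest u) (≤-reflexive (cong key (sym walk-m))))
                   (λ u≡ → u≢last (trans u≡ walk-m))
  ... | i , i<m , i≤u , u≤1+i , u≢1+i =
    suc i , i<m , umbrella i≤u u≤1+i u≢1+i (walk-adj i<m) , only
    where
    only : ∀ {j} → j ≤ m → Adj G u (walk j) → residue j ≡ residue (suc i) → j ≡ suc i
    only {j} j≤m uj eq with residue-≡ j (suc i) eq
    ... | inj₁ j≡1+i = j≡1+i
    -- Here `walk i` is not after `u`, and `u`, as a neighbor of `walk j`, is not after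
    -- `walk (suc j)`; yet `suc j < i`.
    ... | inj₂ (inj₁ (s≤s 2+j≤i)) = contradiction
            (≤-trans i≤u (next-greatest (Adj-sym uj)))
            (<⇒≱ (walk-< 2+j≤i (<⇒≤ i<m)))
    -- By the umbrella property `walk (2 + i)` is adjacent to `walk j`, which lies beyond its last
    -- neighbor `walk (3 + i)`.
    ... | inj₂ (inj₂ 4+i≤j) = contradiction
            (next-greatest (umbrella u≤2+i (<⇒≤ 2+i<j) (λ eq → <⇒≢ 2+i<j (cong key eq)) uj))
            (<⇒≱ (walk-< 4+i≤j j≤m))
      where
      2+i<j : key (walk (2 + i)) < key (walk j)
      2+i<j = walk-< (≤-trans (n≤1+n _) 4+i≤j) j≤m

      u≤2+i : key u ≤ key (walk (2 + i))
      u≤2+i = ≤-trans u≤1+i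
        (<⇒≤ (walk-suc-< (≤-trans (≤-trans (n≤1+n _) (n≤1+n _)) (≤-trans 4+i≤j j≤m))))

  OnWalk? : ∀ u → Dec (∃[ i ] walk (toℕ {suc m} i) ≡ u)
  OnWalk? u = any? λ i → walk (toℕ i) ≟ u

  color : Coloring G 4
  color u with OnWalk? u
  ... | yes (i , _) = suc (residue (toℕ i))
  ... | no  _       = zero

  color-walk : ∀ {i} → i ≤ m → color (walk i) ≡ suc (residue i)
  color-walk {i} i≤m with OnWalk? (walk i)
  ... | yes (j , eq) = cong (suc ∘ residue) (walk-injective (ℕ.≤-pred (toℕ<n j)) i≤m eq)
  ... | no  ∄        =
    contradiction (fromℕ< (s≤s i≤m) , cong walk (toℕ-fromℕ< (s≤s i≤m))) ∄

  color-suc : ∀ {u r} → color u ≡ suc r → ∃[ i ] (i ≤ m × u ≡ walk i × residue i ≡ r)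
  color-suc {u} eq with OnWalk? u
  color-suc refl | yes (i , refl) = toℕ i , ℕ.≤-pred (toℕ<n i) , refl , refl

  color-IsCFON : IsCFON G color
  color-IsCFON u with seen u
    where
    seen : ∀ u → ∃[ i ] UniquelySeen u i
    seen u with u ≟ last
    ... | yes refl   = seen-by-last
    ... | no  u≢last = seen-by-other u≢last
  ... | i , i≤m , ui , only =
    suc (residue i) , ∣p∣≡1⁺ (∈-N∩class⁺ G color ui (color-walk i≤m)) λ y∈ →
      let uy , color-y = ∈-N∩class⁻ G color y∈
          j , j≤m , y≡ , residues = color-suc color-y
      in trans y≡ (cong walk (only j≤m (subst (Adj G u) y≡ uy) residues))

-- Interval representations

-- Locatedness of `x` at `q < r`, with `r` still below `y`, gives `q < x` as wanted or `x < r < y`,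
-- which contradicts the assumption.
≰ℝ⇒≥ℝ : ∀ {x y} → ¬ (x ≤ℝ y) → y ≤ℝ x
≰ℝ⇒≥ℝ {x} {y} x≰y {q} q<y
  with r , q<r , r<y ← Equivalence.to (ℝ.lower-rounded y q) q<y
  with ℝ.located x q<r
... | inj₁ q<x = q<x
... | inj₂ x<r = ⊥-elim (x≰y x≤y)
  where
  x≤y : x ≤ℝ y
  x≤y {s} s<x with ℚ.<-cmp s r
  ... | tri< s<r _ _  = Equivalence.from (ℝ.lower-rounded y s) (r , s<r , r<y)
  ... | tri≈ _ refl _ = r<y
  ... | tri> _ _ r<s  = contradiction
          (s<x , Equivalence.from (ℝ.upper-rounded x s) (r , r<s , x<r))
          (ℝ.disjoint x s)

module Ends
  (G : Graph) (I : V G → Interval)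
  (meets : ∀ u v → u ≢ v → (points (I u) ≬ points (I v)) ⇔ Adj G u v)
  where

  open Graph G using (order; adj?; irrefl)

  -- The right end of I u is at most that of I v.
  _≼_ : Rel (V G) (lsuc 0ℓ)
  u ≼ v = ∀ {x} → points (I u) x → ¬ ¬ (∃[ y ] (points (I v) y × x ≤ℝ y))

  ≼-refl : ∀ {u} → u ≼ u
  ≼-refl {x = x} x∈ ¬∃ = ¬∃ (x , x∈ , id)

  ≼-trans : ∀ {u v w} → u ≼ v → v ≼ w → u ≼ w
  ≼-trans u≼v v≼w x∈ ¬∃ = u≼v x∈ λ (y , y∈ , x≤y) → v≼w y∈ λ (z , z∈ , y≤z) →
    ¬∃ (z , z∈ , λ q → y≤z (x≤y q))

  -- If no point of `I u` were at or above some `y` in `I v`, then `y` would bound all of `I u`,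
  -- giving `u ≼ v`.
  ⋠⇒≽ : ∀ {u v} → ¬ (u ≼ v) → v ≼ u
  ⋠⇒≽ u⋠v {y} y∈ ¬∃ = u⋠v λ {x} x∈ ¬∃′ →
    ¬∃′ (y , y∈ , ≰ℝ⇒≥ℝ {y} {x} λ y≤x → ¬∃ (x , x∈ , y≤x))

  -- From a common point `x` of `I u` and `I w`, climb to `y` in `I v` and on to `z` in `I w`.
  -- Convexity of `I w` puts `y` in it. Adjacency is decidable, so the double negations vanish.
  ≼-umbrella : ∀ {u v w} → u ≼ v → v ≼ w → v ≢ w → Adj G u w → Adj G v w
  ≼-umbrella {u} {v} {w} u≼v v≼w v≢w uw = decidable-stable (adj? v w) λ ¬vw →
    let x , x∈u , x∈w = Equivalence.from (meets u w λ u≡w → irrefl u≡w uw) uw in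
    u≼v x∈u λ (y , y∈v , x≤y) → v≼w y∈v λ (z , z∈w , y≤z) →
    ¬vw (Equivalence.to (meets v w v≢w)
          (y , y∈v , Interval.convex (I w) {x} {y} {z} x∈w z∈w x≤y y≤z))

  -- Excluded middle is doubly negated for each pair, and finitely many double negations combine
  -- into one.
  ¬¬≼-decidable : ¬ ¬ Binary.Decidable _≼_
  ¬¬≼-decidable = sequence rawApplicative λ u → sequence rawApplicative λ v → ¬¬-excluded-middle
    where open RawMonad ¬¬-Monad

  module Key (_≼?_ : Binary.Decidable _≼_) where

    below : V G → Subset order
    below v = tabulate λ w → does (w ≼? v)

    rank : V G → Fin (suc order)
    -- The count ranges from 0 to `order` inclusive, hence `suc order` values.
    rank v = fromℕ< (s≤s (∣p∣≤n (below v)))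

    -- Ties between right ends are broken by the vertex number.
    key : V G → ℕ
    key v = toℕ (combine (rank v) v)

    key-injective : Injective _≡_ _≡_ key
    key-injective {u} {v} = combine-injectiveʳ (rank u) u (rank v) v ∘ toℕ-injective

    -- If `u ⋠ v`, totality makes `below v` a proper subset of `below u`, with `u` itself in the
    -- difference. So `v` has the smaller rank, the leading digit of the key.
    key-≤⇒≼ : ∀ {u v} → key u ≤ key v → u ≼ v
    key-≤⇒≼ {u} {v} u≤v = decidable-stable (u ≼? v) λ u⋠v →
      contradiction u≤v (<⇒≱ (combine-monoˡ-< v u
        (subst₂ _<_ (sym (toℕ-fromℕ< _)) (sym (toℕ-fromℕ< _)) (p⊂q⇒∣p∣<∣q∣ (below-⊂ u⋠v)))))
      where
      below-⊂ : ¬ (u ≼ v) → below v ⊂ below u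
      below-⊂ u⋠v =
        (λ w∈ → ∈-comprehension⁺ (_≼? u)
                  (≼-trans (∈-comprehension⁻ (_≼? v) w∈) (⋠⇒≽ u⋠v))) ,
        u , ∈-comprehension⁺ (_≼? u) ≼-refl , u⋠v ∘ ∈-comprehension⁻ (_≼? v)

-- The upper bound and the minimum

4-colorable : (G : Graph) → IsIntervalGraph G → Connected G →
              ∀ {a b} → Adj G a b → CFONColorable G 4
4-colorable G (I , meets) connected ab =
  decidable-stable (CFONColorable? G 4) (¬¬-map colorable ¬¬≼-decidable)
  where
  open Ends G I meets

  colorable : Binary.Decidable _≼_ → CFONColorable G 4
  colorable _≼?_ = color , color-IsCFON
    where
    open Key _≼?_
    open Greedy G connected key key-injective
      (λ u≤v v≤w → ≼-umbrella (key-≤⇒≼ u≤v) (key-≤⇒≼ v≤w)) ab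

theorem6 : (G : Graph) → IsIntervalGraph G → Connected G →
    2 ≤ length (edges G) →
    ∃[ k ] ((χcf G ≔ k) × 2 ≤ k × k ≤ 4)
-- The minimum is found by deciding 2 and then 3 colors, with 4 as the fallback that always works.
theorem6 G interval connected 2≤∣E∣ with CFONColorable? G 2 | CFONColorable? G 3
... | yes c₂ | _ = 2 , (c₂ , λ _ → 2≤) , ≤-refl , s≤s (s≤s z≤n)
  where
  2≤ : ∀ {m} → CFONColorable G m → 2 ≤ m
  2≤ = 2≤colors G connected 2≤∣E∣
... | no ¬c₂ | yes c₃ = 3 , (c₃ , λ _ → 3≤) , s≤s (s≤s z≤n) , s≤s (s≤s (s≤s z≤n))
  where
  3≤ : ∀ {m} → CFONColorable G m → 3 ≤ m
  3≤ c = ≤∧≢⇒< (2≤colors G connected 2≤∣E∣ c) λ { refl → ¬c₂ c }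
... | no ¬c₂ | no ¬c₃ = 4 , (c₄ , λ _ → 4≤) , s≤s (s≤s z≤n) , ≤-refl
  where
  c₄ : CFONColorable G 4
  c₄ = let _ , _ , _ , e∈ , _ = two-edges G 2≤∣E∣ in
    4-colorable G interval connected (proj₂ (∈-edges⁻ G e∈))

  4≤ : ∀ {m} → CFONColorable G m → 4 ≤ m
  4≤ c = ≤∧≢⇒<
    (≤∧≢⇒< (2≤colors G connected 2≤∣E∣ c) λ { refl → ¬c₂ c }) λ { refl → ¬c₃ c }
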